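{- Let $n \ge 1$ and let $T_R=([n], E_{red})$ and $T_B=([n], E_{blue})$ be two tournaments (a red one and a blue one) on the same vertex set $[n]$. Then there is a vertex $\nu \in [n]$ such that every $j\in[n]$ is reachable from $\nu$ by a rainbow directed path of length at most $2$.
   Context: $[n]=\{1,\dots,n\}$. A tournament $T=([n],E)$ is a directed graph without loops on vertex set $[n]$ such that for every two distinct vertices $i,j$ exactly one of $(i,j)$, $(j,i)$ belongs to $E$. The edges in $E_{red}$ are colored red and the edges in $E_{blue}$ are colored blue; the two tournaments are arbitrary, and a pair $(i,j)$ may be both a red edge and a blue edge. A directed path using edges of $T_R$ and $T_B$ is rainbow if its edges have pairwise different colors. Thus $j$ is reachable from $\nu$ by a rainbow directed path of length at most $2$ if and only if $j=\nu$ (path of length $0$), or $(\nu,j)\in E_{red}$, or $(\nu,j)\in E_{blue}$, or there is $k$ with $(\nu,k)\in E_{red}$ and $(k,j)\in E_{blue}$, or there is $k$ with $(\nu,k)\in E_{blue}$ and $(k,j)\in E_{red}$. -}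

module Defs where

open import Data.Fin.Base using (Fin)
open import Data.List.Base using (List; []; _∷_)
open import Data.List.Relation.Unary.Unique.Propositional using (Unique)
open import Data.Nat.Base using (ℕ; zero; suc; _≤_)
open import Data.Product.Base using (_×_; ∃-syntax)
open import Data.Sum.Base using (_⊎_)
open import Level using (0ℓ)
open import Relation.Binary.Construct.Closure.ReflexiveTransitive using (Star; ε; _◅_)
open import Relation.Binary.Core using (Rel)
open import Relation.Binary.PropositionalEquality.Core using (_≢_)
open import Relation.Nullary.Negation.Core using (¬_)

-- The vertex set [n] is represented by Fin n.
record Tournament (n : ℕ) : Set₁ where
  field
    Edge        : Rel (Fin n) 0ℓ
    loopless    : ∀ i → ¬ Edge i i
    -- A genuine disjunction, so edges of a tournament are decidable.
    exactly-one : ∀ i j → i ≢ j →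
                  (Edge i j × ¬ Edge j i) ⊎ (¬ Edge i j × Edge j i)

open Tournament public

data Colour : Set where
  red blue : Colour

private
  variable
    n   : ℕ
    R B : Tournament n
    i j : Fin n

-- If (i , j) is an edge of both tournaments, then it gives two parallel
-- coloured edges, one of each colour.
data ColouredEdge {n : ℕ} (R B : Tournament n) (i j : Fin n) : Set where
  redEdge  : Edge R i j → ColouredEdge R B i j
  blueEdge : Edge B i j → ColouredEdge R B i j

colour : ColouredEdge R B i j → Colour
colour (redEdge  _) = red
colour (blueEdge _) = blue

Walk : {n : ℕ} → Tournament n → Tournament n → Rel (Fin n) 0ℓ
Walk R B = Star (ColouredEdge R B)

length : Walk R B i j → ℕ
length ε       = zero
length (_ ◅ p) = suc (length p)

vertices : {n : ℕ} {R B : Tournament n} {i j : Fin n} → Walk R B i j → List (Fin n)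
vertices {i = i} ε       = i ∷ []
vertices {i = i} (_ ◅ p) = i ∷ vertices p

colours : Walk R B i j → List Colour
colours ε       = []
colours (e ◅ p) = colour e ∷ colours p

IsPath : Walk R B i j → Set
IsPath p = Unique (vertices p)

Rainbow : Walk R B i j → Set
Rainbow p = Unique (colours p)

RainbowReachableWithin : {n : ℕ} → ℕ → Tournament n → Tournament n → Rel (Fin n) 0ℓ
RainbowReachableWithin ℓ R B i j =
  ∃[ p ] IsPath {R = R} {B = B} {i = i} {j = j} p × Rainbow p × length p ≤ ℓ

{-# OPTIONS --safe #-}

-- Suppose j is not reachable from ν.  Then (j , ν) is an edge of both colours,
-- every red out-neighbour k of ν satisfies (j , k) ∈ E_blue, since otherwise
-- ν → k → j would be rainbow, and likewise with the colours exchanged.  So the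
-- set of out-neighbours of j, in either colour, contains that of ν together
-- with ν itself.  A vertex whose out-neighbourhood is maximal thus works.
module Submission where

open import Defs
open import Data.Empty using (⊥-elim)
open import Data.Fin.Base using (Fin; zero)
open import Data.Fin.Induction using (spo-noetherian)
open import Data.Fin.Properties using (_≟_; all?; any?; ¬∀⟶∃¬)
open import Data.List.Relation.Unary.All using ([]; _∷_)
open import Data.List.Relation.Unary.AllPairs using ([]; _∷_)
open import Data.Nat.Base using (ℕ; _≤_; z≤n; s≤s)
open import Data.Product.Base using (_×_; _,_; ∃-syntax)
open import Data.Sum.Base using (_⊎_; inj₁; inj₂; [_,_])
open import Function.Base using (flip; _∘_)
open import Induction.WellFounded using (Acc; acc)
open import Level using (0ℓ)
open import Relation.Binary.Construct.Closure.ReflexiveTransitive using (ε; _◅_)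
open import Relation.Binary.Core using (Rel)
open import Relation.Binary.Definitions using (Decidable)
open import Relation.Binary.PropositionalEquality using (_≡_; _≢_; refl; isEquivalence; resp₂)
open import Relation.Binary.Structures using (IsStrictPartialOrder)
open import Relation.Nullary.Decidable using (yes; no; map′; _⊎-dec_; _×-dec_)
open import Relation.Nullary.Negation using (¬_)

edge? : ∀ {n} (T : Tournament n) → Decidable (Edge T)
edge? T i j with i ≟ j
... | yes refl = no (loopless T i)
... | no i≢j with exactly-one T i j i≢j
...   | inj₁ (ij , _)  = yes ij
...   | inj₂ (¬ij , _) = no ¬ij

edge⇒≢ : ∀ {n} (T : Tournament n) {i j} → Edge T i j → i ≢ j
edge⇒≢ T ij refl = loopless T _ ij

reverse-edge : ∀ {n} (T : Tournament n) {i j} → i ≢ j → ¬ Edge T i j → Edge T j i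
reverse-edge T {i} {j} i≢j ¬ij with exactly-one T i j i≢j
... | inj₁ (ij , _) = ⊥-elim (¬ij ij)
... | inj₂ (_ , ji) = ji

module _ {n : ℕ} (R B : Tournament n) where

  colouredEdge? : Decidable (ColouredEdge R B)
  colouredEdge? i j =
    map′ [ redEdge , blueEdge ] (λ { (redEdge e) → inj₁ e ; (blueEdge e) → inj₂ e })
         (edge? R i j ⊎-dec edge? B i j)

  colouredEdge⇒≢ : ∀ {i j} → ColouredEdge R B i j → i ≢ j
  colouredEdge⇒≢ (redEdge e)  = edge⇒≢ R e
  colouredEdge⇒≢ (blueEdge e) = edge⇒≢ B e

  RainbowTwoStep : Rel (Fin n) 0ℓ
  RainbowTwoStep i j =
    ∃[ k ] ((Edge R i k × Edge B k j) ⊎ (Edge B i k × Edge R k j))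

  RainbowWithinTwo : Rel (Fin n) 0ℓ
  RainbowWithinTwo i j = i ≡ j ⊎ ColouredEdge R B i j ⊎ RainbowTwoStep i j

  rainbowWithinTwo? : Decidable RainbowWithinTwo
  rainbowWithinTwo? i j =
    (i ≟ j) ⊎-dec colouredEdge? i j ⊎-dec
    any? (λ k → (edge? R i k ×-dec edge? B k j) ⊎-dec (edge? B i k ×-dec edge? R k j))

  twoEdgePath : ∀ {i j k} (e : ColouredEdge R B i k) (f : ColouredEdge R B k j) → i ≢ j →
                colour {R = R} {B = B} e ≢ colour {R = R} {B = B} f →
                RainbowReachableWithin 2 R B i j
  twoEdgePath e f i≢j e≢f =
    e ◅ f ◅ ε ,
    (colouredEdge⇒≢ e ∷ i≢j ∷ []) ∷ (colouredEdge⇒≢ f ∷ []) ∷ [] ∷ [] ,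
    (e≢f ∷ []) ∷ [] ∷ [] ,
    s≤s (s≤s z≤n)

  rainbowWithinTwo⇒reachable : ∀ {i j} → RainbowWithinTwo i j → RainbowReachableWithin 2 R B i j
  rainbowWithinTwo⇒reachable (inj₁ refl) = ε , [] ∷ [] , [] , z≤n
  rainbowWithinTwo⇒reachable (inj₂ (inj₁ e)) =
    e ◅ ε , (colouredEdge⇒≢ e ∷ []) ∷ [] ∷ [] , [] ∷ [] , s≤s z≤n
  rainbowWithinTwo⇒reachable {i} {j} (inj₂ (inj₂ (k , es))) with i ≟ j | es
  ... | yes refl | _            = rainbowWithinTwo⇒reachable (inj₁ refl)
  ... | no i≢j | inj₁ (e , f) = twoEdgePath (redEdge e) (blueEdge f) i≢j λ ()
  ... | no i≢j | inj₂ (e , f) = twoEdgePath (blueEdge e) (redEdge f) i≢j λ ()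

  _◁_ : Rel (Fin n) 0ℓ
  i ◁ j = ColouredEdge R B j i × (∀ {k} → ColouredEdge R B i k → ColouredEdge R B j k)

  ◁-isStrictPartialOrder : IsStrictPartialOrder _≡_ _◁_
  ◁-isStrictPartialOrder = record
    { isEquivalence = isEquivalence
    ; irrefl        = λ { refl (ii , _) → colouredEdge⇒≢ ii refl }
    ; trans         = λ { (ji , i⊆j) (_ , j⊆k) → j⊆k ji , λ e → j⊆k (i⊆j e) }
    ; <-resp-≈      = resp₂ _◁_
    }

  unreachable⇒◁ : ∀ {i j} → ¬ RainbowWithinTwo i j → i ◁ j
  unreachable⇒◁ {i} {j} ¬ij = redEdge (reverse-edge R (¬ij ∘ inj₁) (¬edge ∘ redEdge)) , outNeighbours⊆
    where
    ¬edge : ¬ ColouredEdge R B i j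
    ¬edge = ¬ij ∘ inj₂ ∘ inj₁

    ¬twoStep : ¬ RainbowTwoStep i j
    ¬twoStep = ¬ij ∘ inj₂ ∘ inj₂

    outNeighbours⊆ : ∀ {k} → ColouredEdge R B i k → ColouredEdge R B j k
    outNeighbours⊆ (redEdge e) =
      blueEdge (reverse-edge B (λ { refl → ¬edge (redEdge e) }) λ f → ¬twoStep (_ , inj₁ (e , f)))
    outNeighbours⊆ (blueEdge e) =
      redEdge (reverse-edge R (λ { refl → ¬edge (blueEdge e) }) λ f → ¬twoStep (_ , inj₂ (e , f)))

  climb : ∀ i → Acc (flip _◁_) i → ∃[ ν ] (∀ j → RainbowWithinTwo ν j)
  climb i (acc rs) with all? (rainbowWithinTwo? i)
  ... | yes all = i , all
  ... | no ¬all with ¬∀⟶∃¬ n _ (rainbowWithinTwo? i) ¬all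
  ...   | j , ¬ij = climb j (rs (unreachable⇒◁ ¬ij))

corollary3 : (n : ℕ) → 1 ≤ n → (R B : Tournament n) →
    ∃[ ν ] ((j : Fin n) → RainbowReachableWithin 2 R B ν j)
corollary3 _ (s≤s _) R B =
  let ν , all = climb R B zero (spo-noetherian (◁-isStrictPartialOrder R B) zero)
  in  ν , λ j → rainbowWithinTwo⇒reachable R B (all j)
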